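{- Let $\mathcal{DB}=(\mathcal{D},\mathcal{IC})$ be a database. If $N$ is a $\leq_i$-maximally consistent element in $\mathcal{M}^{\mathcal{DB}}$, then $(\mathrm{Insert}^N,\mathrm{Retract}^N)$ is a $\leq_i$-preferred repair of $\mathcal{DB}$.
   Context: Setting. Fix a first-order language $L$ over a fixed database schema (relation names) and a fixed domain $U$; every element of $U$ has a unique name, quantifiers range over $U$, and equality is identity on $U$. "Atom" means ground atom $P(t)$, with $P$ a relation name and $t$ a tuple over $U$. A database instance is a set of atoms with finite active domain (only finitely many elements of $U$ occur in it). A database is a pair $(\mathcal{D},\mathcal{IC})$ with $\mathcal{D}$ a database instance and $\mathcal{IC}$ (the integrity constraints) a finite set of formulas of $L$. A database to be repaired need not satisfy its integrity constraints. Two-valued semantics. A two-valued valuation assigns $t$ or $f$ to each atom and extends classically to all formulas; a classical (two-valued) model of $\mathcal{IC}$ is such a valuation making all formulas of $\mathcal{IC}$ true. $\mathcal{IC}$ is classically consistent if it has a classical model. For a database instance $\mathcal{D}$, the minimal Herbrand model $\mathcal{H}^{\mathcal{D}}$ assigns $t$ to the atoms in $\mathcal{D}$ and $f$ to all other atoms; $\mathcal{D}\models\mathcal{IC}$ means that $\mathcal{H}^{\mathcal{D}}$ is a model of $\mathcal{IC}$. A database $(\mathcal{D},\mathcal{IC})$ is consistent if $\mathcal{IC}$ is classically consistent and $\mathcal{D}\models\mathcal{IC}$. Repairs. A repair of $(\mathcal{D},\mathcal{IC})$ is a pair $(\mathrm{Insert},\mathrm{Retract})$ of sets of atoms such that (1)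 $\mathrm{Insert}\cap\mathcal{D}=\emptyset$, (2) $\mathrm{Retract}\subseteq\mathcal{D}$, (3) $((\mathcal{D}\cup\mathrm{Insert})\setminus\mathrm{Retract},\mathcal{IC})$ is a consistent database (so, in particular, its first component is a database instance). Set-inclusion preference on repairs: $(I',R')\leq_i(I,R)$ iff $I\subseteq I'$ and $R\subseteq R'$. A repair $(I,R)$ of $\mathcal{DB}$ is $\leq_i$-preferred if for every repair $(I',R')$ of $\mathcal{DB}$, $(I,R)\leq_i(I',R')$ implies $(I',R')\leq_i(I,R)$. Three-valued valuations. The truth values are $t,f,\top$. The order $\leq_k$ has $f<_k\top$ and $t<_k\top$, with $t,f$ incomparable; $\oplus$ is the join for $\leq_k$ (so $x\oplus x=x$, and $x\oplus y=\top$ if $x\neq y$). A three-valued valuation assigns a value in $\{t,f,\top\}$ to each atom. For valuations, $\nu\geq_k\mu$ means $\nu(p)\geq_k\mu(p)$ for every atom $p$, and $(\mathcal{H}^{\mathcal{D}}\oplus M)(p)=\mathcal{H}^{\mathcal{D}}(p)\oplus M(p)$. Write $\nu^{x}=\{p \mid p \text{ an atom},\ \nu(p)=x\}$. Further notation. $\mathrm{Insert}^N=N^{\top}\setminus\mathcal{D}$ and $\mathrm{Retract}^N=N^{\top}\cap\mathcal{D}$. $\mathcal{M}^{\mathcal{DB}}=\{N \mid N \text{ is a three-valued valuation with } N\geq_k\mathcal{H}^{\mathcal{D}}\oplus M \text{ for some classical model } M \text{ of } \mathcal{IC}\}$. An element $N$ of a set $\mathcal{S}$ of three-valued valuations is $\leq_i$-maximally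 consistent in $\mathcal{S}$ if there is no $N'\in\mathcal{S}$ with $N'^{\top}\subsetneq N^{\top}$.
   Formalization: The formal theorem also assumes that only finitely many elements of U occur in atoms of N^⊤; without this the claim fails for infinite U (D empty, IC = {∀x P(x)}), and the assumption follows from the conclusion and is automatic for finite U. -}

module Defs where

open import Level using (0ℓ)
open import Data.Bool using (Bool; true; false; T; not; _∧_; _∨_)
open import Data.Nat using (ℕ; suc)
open import Data.Fin using (Fin)
open import Data.List using (List)
open import Data.List.Relation.Unary.All using (All)
import Data.List.Membership.Propositional as List
open import Data.Product using (∃; ∃-syntax; Σ-syntax; _×_; _,_)
open import Data.Sum using (_⊎_)
open import Data.Vec using (Vec; map; _∷_; lookup)
import Data.Vec.Membership.Propositional as Vec
open import Relation.Binary.Definitions using (DecidableEquality)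
open import Relation.Binary.PropositionalEquality using (_≡_; refl)
open import Relation.Nullary using (¬_; yes; no; does)
open import Relation.Nullary.Negation using (DoubleNegation)
open import Relation.Unary using (Pred)

data Truth₃ : Set where
  t f ⊤ : Truth₃

infix 4 _≤ₖ_ _≟₃_
infixl 6 _⊕_

data _≤ₖ_ : Truth₃ → Truth₃ → Set where
  ≤ₖ-refl : ∀ {x} → x ≤ₖ x
  ≤ₖ-top  : ∀ {x} → x ≤ₖ ⊤

_⊕_ : Truth₃ → Truth₃ → Truth₃
t ⊕ t = t
f ⊕ f = f
_ ⊕ _ = ⊤

_≟₃_ : DecidableEquality Truth₃
t ≟₃ t = yes refl
t ≟₃ f = no λ ()
t ≟₃ ⊤ = no λ ()
f ≟₃ t = no λ ()
f ≟₃ f = yes refl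
f ≟₃ ⊤ = no λ ()
⊤ ≟₃ t = no λ ()
⊤ ≟₃ f = no λ ()
⊤ ≟₃ ⊤ = yes refl

record Schema : Set₁ where
  field
    Rel   : Set
    arity : Rel → ℕ

module Databases (S : Schema) (U : Set) where

  open Schema S

  -- The unique names of the elements of U are the elements themselves.
  data Term (n : ℕ) : Set where
    var  : Fin n → Term n
    name : U → Term n

  -- Formulas with free variables among n de Bruijn indices.
  data Formula (n : ℕ) : Set where
    rel     : (P : Rel) → Vec (Term n) (arity P) → Formula n
    _≐_     : Term n → Term n → Formula n
    ¬̇_      : Formula n → Formula n
    _∧̇_ _∨̇_ _⇒̇_ : Formula n → Formula n → Formula n
    ∀̇_ ∃̇_   : Formula (suc n) → Formula n

  record Atom : Set where
    constructor atom
    field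
      relation : Rel
      args     : Vec U (arity relation)

  -- Sets of atoms are given by characteristic functions, so that the
  -- valuation ℋ 𝓓 below exists without assuming excluded middle.
  AtomSet : Set
  AtomSet = Atom → Bool

  infix 4 _∈_ _⊆_ _⊊_
  infixl 6 _∪_ _∩_ _∖_

  _∈_ : Atom → AtomSet → Set
  p ∈ A = T (A p)

  _⊆_ _⊊_ : AtomSet → AtomSet → Set
  A ⊆ B = ∀ p → p ∈ A → p ∈ B
  A ⊊ B = A ⊆ B × ¬ (B ⊆ A)

  _∪_ _∩_ _∖_ : AtomSet → AtomSet → AtomSet
  (A ∪ B) p = A p ∨ B p
  (A ∩ B) p = A p ∧ B p
  (A ∖ B) p = A p ∧ not (B p)

  ActiveDomain : AtomSet → Pred U 0ℓ
  ActiveDomain A u = ∃[ p ] p ∈ A × u Vec.∈ Atom.args p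

  HasFiniteActiveDomain : AtomSet → Set
  HasFiniteActiveDomain A = ∃[ us ] (∀ u → ActiveDomain A u → u List.∈ us)

  record Instance : Set where
    constructor mkInstance
    field
      atoms  : AtomSet
      finite : HasFiniteActiveDomain atoms

  record Database : Set where
    constructor mkDatabase
    field
      𝓓  : Instance
      𝓘𝓒 : List (∃ Formula)

    open Instance 𝓓 public

  Valuation₂ : Set
  Valuation₂ = Atom → Bool

  Valuation₃ : Set
  Valuation₃ = Atom → Truth₃

  ⟦_⟧ : ∀ {n} → Term n → Vec U n → U
  ⟦ var i ⟧  ρ = lookup ρ i
  ⟦ name u ⟧ ρ = u

  -- Double negations in front of ≡, ⊎ and ∃ make the semantics classical:
  -- every formula is ¬¬-stable, and φ ∨̇ (¬̇ φ) is always true.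
  infix 4 _,_⊨_
  _,_⊨_ : ∀ {n} → Valuation₂ → Vec U n → Formula n → Set
  ν , ρ ⊨ rel P ts = T (ν (atom P (map (λ s → ⟦ s ⟧ ρ) ts)))
  ν , ρ ⊨ (a ≐ b)  = DoubleNegation (⟦ a ⟧ ρ ≡ ⟦ b ⟧ ρ)
  ν , ρ ⊨ (¬̇ φ)    = ¬ (ν , ρ ⊨ φ)
  ν , ρ ⊨ (φ ∧̇ ψ)  = (ν , ρ ⊨ φ) × (ν , ρ ⊨ ψ)
  ν , ρ ⊨ (φ ∨̇ ψ)  = DoubleNegation ((ν , ρ ⊨ φ) ⊎ (ν , ρ ⊨ ψ))
  ν , ρ ⊨ (φ ⇒̇ ψ)  = (ν , ρ ⊨ φ) → (ν , ρ ⊨ ψ)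
  ν , ρ ⊨ (∀̇ φ)    = ∀ u → ν , (u ∷ ρ) ⊨ φ
  ν , ρ ⊨ (∃̇ φ)    = DoubleNegation (∃[ u ] (ν , (u ∷ ρ) ⊨ φ))

  -- Free variables are read universally.
  IsModel : Valuation₂ → List (∃ Formula) → Set
  IsModel ν = All λ (n , φ) → (ρ : Vec U n) → ν , ρ ⊨ φ

  ClassicallyConsistent : List (∃ Formula) → Set
  ClassicallyConsistent 𝓘𝓒 = ∃[ ν ] IsModel ν 𝓘𝓒

  -- The minimal Herbrand model of 𝓓 is its characteristic function.
  ℋ : Instance → Valuation₂
  ℋ = Instance.atoms

  Consistent : Database → Set
  Consistent DB = ClassicallyConsistent 𝓘𝓒 × IsModel (ℋ 𝓓) 𝓘𝓒
    where open Database DB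

  IsRepair : Database → AtomSet × AtomSet → Set
  IsRepair DB (Ins , Ret) =
    (∀ p → p ∈ Ins → ¬ p ∈ atoms) ×
    Ret ⊆ atoms ×
    Σ[ finite ∈ HasFiniteActiveDomain ((atoms ∪ Ins) ∖ Ret) ]
      Consistent (mkDatabase (mkInstance ((atoms ∪ Ins) ∖ Ret) finite) 𝓘𝓒)
    where open Database DB

  -- The smaller repair is the less preferred one: it changes more atoms.
  infix 4 _≤ᵢ_
  _≤ᵢ_ : AtomSet × AtomSet → AtomSet × AtomSet → Set
  (I′ , R′) ≤ᵢ (I , R) = I ⊆ I′ × R ⊆ R′

  IsPreferredRepair : Database → AtomSet × AtomSet → Set
  IsPreferredRepair DB IR =
    IsRepair DB IR ×
    (∀ IR′ → IsRepair DB IR′ → IR ≤ᵢ IR′ → IR′ ≤ᵢ IR)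

  embed : Bool → Truth₃
  embed true  = t
  embed false = f

  infixl 6 _⊕ᵥ_
  _⊕ᵥ_ : Valuation₂ → Valuation₂ → Valuation₃
  (ν ⊕ᵥ μ) p = embed (ν p) ⊕ embed (μ p)

  infix 4 _≥ᵥ_
  _≥ᵥ_ : Valuation₃ → Valuation₃ → Set
  ν ≥ᵥ μ = ∀ p → μ p ≤ₖ ν p

  infixl 8 _^_
  _^_ : Valuation₃ → Truth₃ → AtomSet
  (ν ^ x) p = does (ν p ≟₃ x)

  Insert Retract : Database → Valuation₃ → AtomSet
  Insert  DB N = N ^ ⊤ ∖ Database.atoms DB
  Retract DB N = N ^ ⊤ ∩ Database.atoms DB

  𝓜 : Database → Pred Valuation₃ 0ℓ
  𝓜 DB N = ∃[ M ] IsModel M 𝓘𝓒 × N ≥ᵥ ℋ 𝓓 ⊕ᵥ M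
    where open Database DB

  MaximallyConsistent : Pred Valuation₃ 0ℓ → Pred Valuation₃ 0ℓ
  MaximallyConsistent 𝓢 N = 𝓢 N × ¬ (∃[ N′ ] 𝓢 N′ × N′ ^ ⊤ ⊊ N ^ ⊤)

{-# OPTIONS --safe #-}

-- A model M of the constraints changes exactly the atoms in (ℋ 𝓓 ⊕ᵥ M) ^ ⊤, so
-- whenever this set lies inside N ^ ⊤, maximality of N forces equality. For the M
-- witnessing N ∈ 𝓜 DB, this shows that the update of 𝓓 by N is M itself; for
-- the model M produced by a repair contained in the one of N, it shows that the
-- two repairs coincide.
module Submission where

open import Data.Bool using (true; false; T; T?)
open import Data.Bool.Properties using (T-∧; T-∨)
open import Data.Empty using (⊥-elim)
open import Data.List using (List; _++_)
open import Data.List.Membership.Propositional.Properties using (∈-++⁺ˡ; ∈-++⁺ʳ)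
import Data.List.Relation.Unary.All as All
open import Data.Product using (∃; _×_; _,_; proj₁; proj₂; map₂)
open import Data.Sum as Sum using (_⊎_; inj₁; inj₂; [_,_]′)
open import Data.Vec using (Vec; _∷_)
open import Function using (_∘_; case_of_)
open import Function.Bundles using (Equivalence)
open import Relation.Binary.PropositionalEquality using (_≗_; refl; sym; subst)
open import Relation.Nullary using (¬_)
open import Relation.Nullary.Decidable using (decidable-stable)
open import Defs

open Equivalence using (to)

module _ {S : Schema} {U : Set} where

  open Databases S U

  -- The updated instance agrees with the model only pointwise, so truth is carried over by
  -- induction on the formula. Negations and premises need the reversed agreement.
  ⊨-resp-≗ : ∀ {n} {ν μ : Valuation₂} → ν ≗ μ →
             (φ : Formula n) (ρ : Vec U n) → ν , ρ ⊨ φ → μ , ρ ⊨ φ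
  ⊨-resp-≗ e (rel P ts) ρ h = subst T (e _) h
  ⊨-resp-≗ e (a ≐ b)    ρ h = h
  ⊨-resp-≗ e (¬̇ φ)      ρ h = h ∘ ⊨-resp-≗ (sym ∘ e) φ ρ
  ⊨-resp-≗ e (φ ∧̇ ψ)    ρ (h , k) = ⊨-resp-≗ e φ ρ h , ⊨-resp-≗ e ψ ρ k
  ⊨-resp-≗ e (φ ∨̇ ψ)    ρ h k = h (k ∘ Sum.map (⊨-resp-≗ e φ ρ) (⊨-resp-≗ e ψ ρ))
  ⊨-resp-≗ e (φ ⇒̇ ψ)    ρ h = ⊨-resp-≗ e ψ ρ ∘ h ∘ ⊨-resp-≗ (sym ∘ e) φ ρ
  ⊨-resp-≗ e (∀̇ φ)      ρ h u = ⊨-resp-≗ e φ (u ∷ ρ) (h u)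
  ⊨-resp-≗ e (∃̇ φ)      ρ h k = h (k ∘ map₂ (⊨-resp-≗ e φ _))

  IsModel-resp-≗ : ∀ {ν μ} → ν ≗ μ → (Φ : List (∃ Formula)) → IsModel ν Φ → IsModel μ Φ
  IsModel-resp-≗ e Φ = All.map λ {(_ , φ)} h ρ → ⊨-resp-≗ e φ ρ (h ρ)

  ^⊤-mono : ∀ {ν μ : Valuation₃} → ν ≥ᵥ μ → μ ^ ⊤ ⊆ ν ^ ⊤
  ^⊤-mono {ν} {μ} ν≥μ p h with μ p | ν p | ν≥μ p
  ... | _ | _ | ≤ₖ-refl = h
  ... | _ | _ | ≤ₖ-top  = _

  ≥ᵥ-refl : ∀ {ν : Valuation₃} → ν ≥ᵥ ν
  ≥ᵥ-refl _ = ≤ₖ-refl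

  -- `ℋ 𝓓 ⊕ᵥ M` itself lies in `𝓜 DB`, so its `⊤` atoms cannot form a proper subset of those of `N`.
  -- This only refutes non-membership; decidability of Boolean sets then gives membership.
  maximal⇒⊆ : ∀ {DB N M} → let open Database DB in
              MaximallyConsistent (𝓜 DB) N → IsModel M 𝓘𝓒 →
              (ℋ 𝓓 ⊕ᵥ M) ^ ⊤ ⊆ N ^ ⊤ → N ^ ⊤ ⊆ (ℋ 𝓓 ⊕ᵥ M) ^ ⊤
  maximal⇒⊆ (_ , max) model sub p p∈N = decidable-stable (T? _) λ p∉ →
    max (_ , (_ , model , ≥ᵥ-refl) , sub , λ N⊆ → p∉ (N⊆ p p∈N))

  -- The join is `⊤` only where `A` and its update disagree; the omitted cases are those of
  -- agreement.
  update-changes : ∀ (A I R : AtomSet) p → p ∈ (A ⊕ᵥ ((A ∪ I) ∖ R)) ^ ⊤ →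
                   (p ∈ I × ¬ p ∈ A) ⊎ (p ∈ R × p ∈ A)
  update-changes A I R p h with A p | I p | R p
  ... | true  | _     | true  = inj₂ _
  ... | false | true  | false = inj₁ (_ , λ ())

  -- By the two inclusions `K` is where `A` and `M` disagree, and the update flips `A` exactly on
  -- `K`.
  update≗ : ∀ {A M K : AtomSet} → (A ⊕ᵥ M) ^ ⊤ ⊆ K → K ⊆ (A ⊕ᵥ M) ^ ⊤ →
            (A ∪ (K ∖ A)) ∖ (K ∩ A) ≗ M
  update≗ {A} {M} {K} ⊆K K⊆ p with A p | M p | K p | ⊆K p | K⊆ p
  ... | true  | true  | false | _ | _ = refl
  ... | true  | true  | true  | _ | h = ⊥-elim (h _)
  ... | true  | false | true  | _ | _ = refl
  ... | true  | false | false | h | _ = ⊥-elim (h _)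
  ... | false | true  | true  | _ | _ = refl
  ... | false | true  | false | h | _ = ⊥-elim (h _)
  ... | false | false | false | _ | _ = refl
  ... | false | false | true  | _ | h = ⊥-elim (h _)

  ∈∖⁻ : ∀ (A B : AtomSet) p → p ∈ A ∖ B → p ∈ A × ¬ p ∈ B
  ∈∖⁻ A B p h with A p | B p
  ... | true | false = _ , λ ()

  ∈∩⁻ : ∀ (A B : AtomSet) p → p ∈ A ∩ B → p ∈ A × p ∈ B
  ∈∩⁻ A B p = to T-∧

  -- Retracting adds no names, and the names in `I` already occur in `K`.
  update-finite : ∀ {A I R K : AtomSet} → HasFiniteActiveDomain A → I ⊆ K →
                  HasFiniteActiveDomain K → HasFiniteActiveDomain ((A ∪ I) ∖ R)
  update-finite {A} {I} {R} (us , A⊆) I⊆K (vs , K⊆) = us ++ vs , λ u (p , h , u∈) →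
    [ (λ p∈A → ∈-++⁺ˡ (A⊆ u (p , p∈A , u∈)))
    , (λ p∈I → ∈-++⁺ʳ us (K⊆ u (p , I⊆K p p∈I , u∈))) ]′
    (to (T-∨ {A p}) (proj₁ (∈∖⁻ (A ∪ I) R p h)))

proposition5 : (S : Schema) (U : Set) →
    let open Databases S U in
    (DB : Database) (N : Valuation₃) →
    -- Without this hypothesis the claim fails for infinite U: for 𝓓 = ∅ and
    -- 𝓘𝓒 = { ∀x P(x) } a maximally consistent N exists but there is no repair.
    -- It holds automatically for finite U, and it follows from the conclusion.
    HasFiniteActiveDomain (N ^ ⊤) →
    MaximallyConsistent (𝓜 DB) N →
    IsPreferredRepair DB (Insert DB N , Retract DB N)
proposition5 S U DB N fin max@((M , model , N≥) , _) = isRepair , preferred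
  where
  open Databases S U
  open Database DB

  ins⁻ : ∀ p → p ∈ Insert DB N → p ∈ N ^ ⊤ × ¬ p ∈ atoms
  ins⁻ = ∈∖⁻ (N ^ ⊤) atoms

  ret⁻ : ∀ p → p ∈ Retract DB N → p ∈ N ^ ⊤ × p ∈ atoms
  ret⁻ = ∈∩⁻ (N ^ ⊤) atoms

  changes⊆N : (ℋ 𝓓 ⊕ᵥ M) ^ ⊤ ⊆ N ^ ⊤
  changes⊆N = ^⊤-mono N≥

  updated≗M : (atoms ∪ Insert DB N) ∖ Retract DB N ≗ M
  updated≗M = update≗ changes⊆N (maximal⇒⊆ {DB = DB} max model changes⊆N)

  isRepair : IsRepair DB (Insert DB N , Retract DB N)
  isRepair =
      (λ p → proj₂ ∘ ins⁻ p)
    , (λ p → proj₂ ∘ ret⁻ p)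
    , update-finite {R = Retract DB N} finite (λ p → proj₁ ∘ ins⁻ p) fin
    , (M , model)
    , IsModel-resp-≗ (sym ∘ updated≗M) 𝓘𝓒 model

  preferred : ∀ IR′ → IsRepair DB IR′ → (Insert DB N , Retract DB N) ≤ᵢ IR′ →
              IR′ ≤ᵢ (Insert DB N , Retract DB N)
  preferred (I , R) (_ , _ , _ , _ , model′) (I⊆ , R⊆) = ins⊆ , ret⊆
    where
    changes = update-changes atoms I R

    changes⊆ : (ℋ 𝓓 ⊕ᵥ ((atoms ∪ I) ∖ R)) ^ ⊤ ⊆ N ^ ⊤
    -- `≤ᵢ` puts `I` and `R` inside `Insert DB N` and `Retract DB N`, hence inside `N ^ ⊤`.
    changes⊆ p h =
      [ (λ (i , _) → proj₁ (ins⁻ p (I⊆ p i))) , (λ (r , _) → proj₁ (ret⁻ p (R⊆ p r))) ]′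
      (changes p h)

    N⊆ = maximal⇒⊆ {DB = DB} max model′ changes⊆

    ins⊆ : Insert DB N ⊆ I
    -- Outside `𝓓` a change made by the repair cannot be a retraction, so it is an insertion.
    ins⊆ p h = case ins⁻ p h of λ (p∈N , p∉𝓓) →
      [ proj₁ , (λ (_ , p∈𝓓) → ⊥-elim (p∉𝓓 p∈𝓓)) ]′ (changes p (N⊆ p p∈N))

    ret⊆ : Retract DB N ⊆ R
    ret⊆ p h = case ret⁻ p h of λ (p∈N , p∈𝓓) →
      [ (λ (_ , p∉𝓓) → ⊥-elim (p∉𝓓 p∈𝓓)) , proj₁ ]′ (changes p (N⊆ p p∈N))
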